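{- For every integer $n\geq 109$ with $n\equiv 0$ or $1\pmod 3$, there exists a uniquely 2-chromatic $P_4$ system of order $n$.
   Context: $P_4=(a_1,a_2,a_3,a_4)$ denotes the path on four distinct vertices with edges $\{a_1,a_2\},\{a_2,a_3\},\{a_3,a_4\}$. A $P_4$ system of order $n>1$ is a pair $(V,\mathcal B)$ where $|V|=n$ and $\mathcal B$ is a set of $P_4$ paths with vertices in $V$ whose edge sets partition the edge set of the complete graph on $V$. A $k$-colouring of $(V,\mathcal B)$ is an assignment of one of $k$ colours to each vertex of $V$ such that no path in $\mathcal B$ is monochromatic. The system is $k$-colourable if it has a $k$-colouring, and $k$-chromatic if it is $k$-colourable but not $(k-1)$-colourable. It is uniquely $2$-chromatic if it is 2-chromatic and every 2-colouring can be obtained from some fixed 2-colouring by a permutation of the two colours. -}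

module Defs where

open import Data.Fin.Base using (Fin)
open import Data.Fin.Permutation using (Permutation′; _⟨$⟩ʳ_)
open import Data.List.Base using (List; []; _∷_; length; lookup)
open import Data.List.Relation.Unary.All using (All)
open import Data.List.Relation.Unary.Any using (Any)
open import Data.List.Relation.Unary.Unique.Propositional using (Unique)
open import Data.Nat.Base using (ℕ; _<_; _∸_)
open import Data.Product using (_×_; _,_; ∃-syntax; Σ-syntax; ∃!)
open import Data.Sum.Base using (_⊎_)
open import Relation.Binary.PropositionalEquality using (_≡_; _≢_)
open import Relation.Nullary using (¬_)

record P₄ (n : ℕ) : Set where
  constructor path
  field
    a₁ a₂ a₃ a₄ : Fin n

  vertices : List (Fin n)
  vertices = a₁ ∷ a₂ ∷ a₃ ∷ a₄ ∷ []

  edges : List (Fin n × Fin n)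
  edges = (a₁ , a₂) ∷ (a₂ , a₃) ∷ (a₃ , a₄) ∷ []

  field
    distinct : Unique vertices

open P₄ public using (vertices; edges)

-- Edges are unordered, so a pair is identified with its swap.
HasEdge : ∀ {n} → P₄ n → Fin n → Fin n → Set
HasEdge p x y = Any (λ e → e ≡ (x , y) ⊎ e ≡ (y , x)) (edges p)

-- The set of paths is given as a list.  Uniqueness in `partition` is of the
-- position in the list, so no path (in either orientation) can be repeated.
record P₄System (n : ℕ) : Set where
  field
    order>1   : 1 < n
    blocks    : List (P₄ n)
    partition : ∀ (x y : Fin n) → x ≢ y →
                ∃! _≡_ λ (i : Fin (length blocks)) → HasEdge (lookup blocks i) x y

open P₄System public using (blocks)

Monochromatic : ∀ {n k} → (Fin n → Fin k) → P₄ n → Set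
Monochromatic c p = ∃[ q ] All (λ v → c v ≡ q) (vertices p)

IsColouring : ∀ {n} → P₄System n → (k : ℕ) → (Fin n → Fin k) → Set
IsColouring S k c = All (λ p → ¬ Monochromatic c p) (blocks S)

Colourable : ∀ {n} → P₄System n → ℕ → Set
Colourable S k = ∃[ c ] IsColouring S k c

-- At k = 0 truncated subtraction is harmless: the vertex set is nonempty, so
-- no system is 0-colourable.
Chromatic : ∀ {n} → P₄System n → ℕ → Set
Chromatic S k = Colourable S k × ¬ Colourable S (k ∸ 1)

Uniquely2Chromatic : ∀ {n} → P₄System n → Set
Uniquely2Chromatic {n} S =
  Chromatic S 2 ×
  ∃[ c₀ ] (IsColouring S 2 c₀ ×
           (∀ (c : Fin n → Fin 2) → IsColouring S 2 c →
            Σ[ π ∈ Permutation′ 2 ] (∀ v → c v ≡ π ⟨$⟩ʳ c₀ v)))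

{-# OPTIONS --safe #-}

-- Given a uniquely 2-coloured system on V, add three vertices x, y, z and
-- decompose the new edges so that every 2-colouring is forced to give x the
-- colour 0 and y, z the colour 1.  Two vertices u, v of V and a "centre" x
-- yield the paths x u y v and x v z u.  If u, v are coloured q, these paths
-- forbid q on both of x, y and on both of x, z.  Pairs coloured 0 with centres
-- x and y together with a pair coloured 1 with centre x leave only 0, 1, 1.
-- The forcing pairs can stay in a base system forever: when V itself grows by
-- three vertices, the decomposition of the new edges grows by a K₃,₃ only, whose
-- paths alternate between the two sides and are never monochromatic.  It remains
-- to give base systems of orders 18 and 19; they come from a local search, and
-- backtracking verifies that their colouring is unique.
module Submission where

open import Defs
open import Data.Nat using (ℕ; _≥_; _%_)
open import Data.Product using (Σ)
open import Data.Sum using (_⊎_)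
open import Relation.Binary.PropositionalEquality using (_≡_)

open import Agda.Builtin.FromNat using (Number; fromNat)
open import Data.Bool.Base using (Bool; true; false; T; _∧_; _∨_; if_then_else_)
open import Data.Bool.Properties using (T-∧; T-∨)
open import Data.Empty using (⊥-elim)
open import Data.Fin.Base using (Fin; zero; suc; _↑ˡ_; _↑ʳ_; lift; opposite)
open import Data.Fin.Literals using (number)
open import Data.Fin.Patterns
open import Data.Fin.Permutation as Perm using (Permutation′; _⟨$⟩ʳ_; _⟨$⟩ˡ_)
open import Data.Fin.Properties
  using (_≟_; all?; any?; ↑ˡ-injective; ↑ʳ-injective; lift-injective)
open import Data.List.Base using (List; []; _∷_; _++_; map; filter; lookup; null; allFin)
open import Data.List.Membership.Propositional.Properties using (∈-lookup)
open import Data.List.Relation.Unary.All as All using (All; []; _∷_)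
import Data.List.Relation.Unary.All.Properties as All
open import Data.List.Relation.Unary.Any as Any using (Any; here; there)
import Data.List.Relation.Unary.Any.Properties as Any
import Data.List.Relation.Unary.Unique.DecPropositional as DecUnique
import Data.List.Relation.Unary.Unique.Propositional.Properties as Unique
import Data.Nat.Base as ℕ
open import Data.Nat.Base using (_+_; _*_; _/_)
import Data.Nat.DivMod as ℕ
import Data.Nat.Literals as ℕ
import Data.Nat.Properties as ℕ
open import Data.Product using (_×_; _,_; proj₁; proj₂; ∃; ∃!)
import Data.Product.Base as Product
import Data.Product.Properties as Product
open import Data.Sum.Base using (inj₁; inj₂)
import Data.Sum.Base as Sum
open import Data.Unit.Base using (tt)
open import Data.Vec.Base as Vec using (Vec; []; _∷_)
open import Function.Base using (_∘_; id)
open import Function.Bundles using (Equivalence; mk⇔)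
open import Function.Definitions using (Injective)
open import Relation.Binary.PropositionalEquality
  using (_≢_; _≗_; refl; sym; trans; cong; cong₂; subst; module ≡-Reasoning)
open import Relation.Nullary using (¬_; Dec; yes; no; does; contradiction)
open import Relation.Nullary.Decidable
  using (True; toWitness; map′; does-⇔; ¬?; _×-dec_; _⊎-dec_; _→-dec_)

instance
  numberℕ : Number ℕ
  numberℕ = ℕ.number

  numberFin : ∀ {n} → Number (Fin n)
  numberFin = number _

private variable
  m n : ℕ

-- Relabelling of paths and edge multiplicities

embed : (f : Fin m → Fin n) → Injective _≡_ _≡_ f → P₄ m → P₄ n
embed f inj (path a b c d u) = path (f a) (f b) (f c) (f d) (Unique.map⁺ inj u)

hasEdge? : (p : P₄ n) (x y : Fin n) → Dec (HasEdge p x y)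
hasEdge? p x y = Any.any? (λ e → joins? e (x , y) ⊎-dec joins? e (y , x)) (edges p)
  where
  joins? : (e f : Fin _ × Fin _) → Dec (e ≡ f)
  joins? (a , b) (c , d) =
    map′ (λ { (refl , refl) → refl }) (λ { refl → refl , refl }) (a ≟ c ×-dec b ≟ d)

HasEdge-sym : (p : P₄ n) {x y : Fin n} → HasEdge p x y → HasEdge p y x
HasEdge-sym p = Any.map Sum.swap

indicator : ∀ {A : Set} → Dec A → ℕ
indicator a? = if does a? then 1 else 0

indicator-cong : ∀ {A B : Set} (a? : Dec A) (b? : Dec B) → (A → B) → (B → A) →
                 indicator a? ≡ indicator b?
indicator-cong a? b? f g = cong (if_then 1 else 0) (does-⇔ (mk⇔ f g) a? b?)

-- Counting the paths through a pair, rather than locating one, makes coverage additive over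
-- concatenation, stable under embeddings and decidable by evaluation.
count : List (P₄ n) → Fin n → Fin n → ℕ
count []       x y = 0
count (p ∷ ps) x y = indicator (hasEdge? p x y) + count ps x y

count-++ : ∀ (ps qs : List (P₄ n)) x y → count (ps ++ qs) x y ≡ count ps x y + count qs x y
count-++ []       qs x y = refl
count-++ (p ∷ ps) qs x y =
  trans (cong (i +_) (count-++ ps qs x y)) (sym (ℕ.+-assoc i (count ps x y) (count qs x y)))
  where i = indicator (hasEdge? p x y)

count-sym : ∀ (ps : List (P₄ n)) x y → count ps x y ≡ count ps y x
count-sym []       x y = refl
count-sym (p ∷ ps) x y = cong₂ _+_
  (indicator-cong (hasEdge? p x y) (hasEdge? p y x) (HasEdge-sym p) (HasEdge-sym p))
  (count-sym ps x y)

module _ (f : Fin m → Fin n) (inj : Injective _≡_ _≡_ f) where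

  HasEdge-embed⁺ : ∀ (p : P₄ m) {x y} → HasEdge p x y → HasEdge (embed f inj p) (f x) (f y)
  HasEdge-embed⁺ p = Any.map⁺ ∘ Any.map (Sum.map (cong f²) (cong f²))
    where f² = Product.map f f

  HasEdge-embed⁻ : ∀ (p : P₄ m) {x y} → HasEdge (embed f inj p) (f x) (f y) → HasEdge p x y
  HasEdge-embed⁻ p = Any.map (Sum.map f²-inj f²-inj) ∘ Any.map⁻ {xs = edges p}
    where
    f²-inj : ∀ {a b c d} → (f a , f b) ≡ (f c , f d) → (a , b) ≡ (c , d)
    f²-inj eq = cong₂ _,_ (inj (Product.,-injectiveˡ eq)) (inj (Product.,-injectiveʳ eq))

  HasEdge-embed-range : ∀ (p : P₄ m) {u v} → HasEdge (embed f inj p) u v → ∃ λ x → f x ≡ u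
  HasEdge-embed-range p e with Any.satisfied (Any.map⁻ {xs = edges p} e)
  ... | (a , _) , inj₁ refl = a , refl
  ... | (_ , b) , inj₂ refl = b , refl

  count-embed : ∀ ps x y → count (map (embed f inj) ps) (f x) (f y) ≡ count ps x y
  count-embed []       x y = refl
  count-embed (p ∷ ps) x y = cong₂ _+_
    (indicator-cong (hasEdge? (embed f inj p) (f x) (f y)) (hasEdge? p x y)
      (HasEdge-embed⁻ p) (HasEdge-embed⁺ p))
    (count-embed ps x y)

  count-outsideˡ : ∀ ps {u} → (∀ x → f x ≢ u) → ∀ v → count (map (embed f inj) ps) u v ≡ 0
  count-outsideˡ []       u∉f v = refl
  count-outsideˡ (p ∷ ps) u∉f v = cong₂ _+_
    (indicator-cong (hasEdge? (embed f inj p) _ v) (no id)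
      (λ e → let x , fx≡u = HasEdge-embed-range p e in u∉f x fx≡u) ⊥-elim)
    (count-outsideˡ ps u∉f v)

  count-outsideʳ : ∀ ps {v} → (∀ x → f x ≢ v) → ∀ u → count (map (embed f inj) ps) u v ≡ 0
  count-outsideʳ ps v∉f u = trans (count-sym (map (embed f inj) ps) u _) (count-outsideˡ ps v∉f u)

count≡0⇒∄ : ∀ (ps : List (P₄ n)) x y → count ps x y ≡ 0 → ∀ i → ¬ HasEdge (lookup ps i) x y
count≡0⇒∄ (p ∷ ps) x y = go (hasEdge? p x y)
  where
  -- With the decision as an argument, matching on it lets `indicator` reduce. The case `yes` is
  -- absent because it would equate a successor with 0.
  go : (p? : Dec (HasEdge p x y)) → indicator p? + count ps x y ≡ 0 →
       ∀ i → ¬ HasEdge (lookup (p ∷ ps) i) x y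
  go (no ¬e) eq zero    = ¬e
  go (no ¬e) eq (suc i) = count≡0⇒∄ ps x y eq i

count≡1⇒∃! : ∀ (ps : List (P₄ n)) x y → count ps x y ≡ 1 →
             ∃! _≡_ λ i → HasEdge (lookup ps i) x y
count≡1⇒∃! (p ∷ ps) x y = go (hasEdge? p x y)
  where
  go : (p? : Dec (HasEdge p x y)) → indicator p? + count ps x y ≡ 1 →
       ∃! _≡_ λ i → HasEdge (lookup (p ∷ ps) i) x y
  go (yes e) eq = zero , e ,
    λ { {zero}  _  → refl
      ; {suc j} e′ → contradiction e′ (count≡0⇒∄ ps x y (ℕ.suc-injective eq) j) }
  go (no ¬e) eq = let i , e , i! = count≡1⇒∃! ps x y eq in suc i , e ,
    λ { {zero}  e′ → contradiction e′ ¬e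
      ; {suc j} e′ → cong suc (i! e′) }

Partitions : List (P₄ n) → Set
Partitions ps = ∀ x y → x ≢ y → count ps x y ≡ 1

partitions? : (ps : List (P₄ n)) → Dec (Partitions ps)
partitions? ps = all? λ x → all? λ y → ¬? (x ≟ y) →-dec (count ps x y ℕ.≟ 1)

-- Colourings

Proper : (Fin n → Fin 2) → List (P₄ n) → Set
Proper c = All (λ p → ¬ Monochromatic c p)

proper? : (c : Fin n → Fin 2) (ps : List (P₄ n)) → Dec (Proper c ps)
proper? c = All.all? λ p → ¬? (any? λ q → All.all? (λ v → c v ≟ q) (vertices p))

Proper-cong : ∀ {c d : Fin n → Fin 2} {ps} → c ≗ d → Proper c ps → Proper d ps
Proper-cong c≗d = All.map λ ¬mono (q , ds) → ¬mono (q , All.map (λ {v} → trans (c≗d v)) ds)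

module _ (f : Fin m → Fin n) (inj : Injective _≡_ _≡_ f) {c : Fin n → Fin 2} where

  Proper-embed⁺ : ∀ {ps} → Proper (c ∘ f) ps → Proper c (map (embed f inj) ps)
  Proper-embed⁺ = All.map⁺ ∘ All.map λ {p} ¬mono (q , cs) → ¬mono (q , All.map⁻ {xs = vertices p} cs)

  Proper-embed⁻ : ∀ {ps} → Proper c (map (embed f inj) ps) → Proper (c ∘ f) ps
  Proper-embed⁻ = All.map (λ {p} ¬mono (q , cs) → ¬mono (q , All.map⁺ {xs = vertices p} cs)) ∘ All.map⁻

-- Fixing the colour of one vertex breaks the symmetry between the two colours, so uniqueness up to
-- permutation becomes pointwise equality.
Rigid : (root : Fin n) → (Fin n → Fin 2) → List (P₄ n) → Set
Rigid root c₀ ps = ∀ c → Proper c ps → c root ≡ c₀ root → c ≗ c₀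

rigid⇒uniquely2Chromatic :
  1 ℕ.< n → (ps : List (P₄ n)) → Partitions ps →
  ∀ {root c₀} → Proper c₀ ps → Rigid root c₀ ps → Σ (P₄System n) Uniquely2Chromatic
rigid⇒uniquely2Chromatic 1<n@(ℕ.s≤s (ℕ.s≤s _)) ps parts {root} {c₀} proper rigid =
  S , ((c₀ , proper) , not1Colourable) , c₀ , proper , unique
  where
  S : P₄System _
  S = record { order>1 = 1<n ; blocks = ps
             ; partition = λ x y x≢y → count≡1⇒∃! ps x y (parts x y x≢y) }

  not1Colourable : ¬ Colourable S 1
  not1Colourable (c , col) =
    -- Vertices 0 and 1 exist by `1<n`, so some block contains their edge; a single colour makes
    -- that block monochromatic.
    let i , _ = P₄System.partition S zero (suc zero) λ ()
        p     = lookup ps i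
    in All.lookup col (∈-lookup i) (0F , All.universal (λ v → constant (c v)) (vertices p))
    where
    constant : ∀ (q : Fin 1) → q ≡ 0F
    constant 0F = refl

  aligning : ∀ (q r : Fin 2) → ∃ λ (π : Permutation′ 2) → q ≡ π ⟨$⟩ʳ r
  aligning 0F 0F = Perm.id , refl
  aligning 0F 1F = Perm.reverse , refl
  aligning 1F 0F = Perm.reverse , refl
  aligning 1F 1F = Perm.id , refl

  unique : ∀ c → IsColouring S 2 c → Σ (Permutation′ 2) λ π → ∀ v → c v ≡ π ⟨$⟩ʳ c₀ v
  unique c col = π , λ v → trans (sym (Perm.inverseʳ π)) (cong (π ⟨$⟩ʳ_) (agree v))
    where
    π = proj₁ (aligning (c root) (c₀ root))

    -- Undoing `π` makes the colouring agree with `c₀` at the root, where rigidity applies.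
    d = (π ⟨$⟩ˡ_) ∘ c

    d-proper : Proper d ps
    d-proper = All.map (λ ¬mono (q , ds) → ¬mono
      (π ⟨$⟩ʳ q , All.map (λ e → trans (sym (Perm.inverseʳ π)) (cong (π ⟨$⟩ʳ_) e)) ds)) col

    agree : d ≗ c₀
    agree = rigid d d-proper
      (trans (cong (π ⟨$⟩ˡ_) (proj₂ (aligning (c root) (c₀ root)))) (Perm.inverseˡ π))

-- Backtracking

-- (q , vs) forbids that all of vs are coloured q.
Clause : ℕ → Set
Clause n = Fin 2 × List (Fin n)

Satisfies : (Fin n → Fin 2) → Clause n → Set
Satisfies c (q , vs) = ¬ All (λ v → c v ≡ q) vs

lower : List (Fin (ℕ.suc n)) → List (Fin n)
lower []           = []
lower (zero  ∷ vs) = lower vs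
lower (suc v ∷ vs) = v ∷ lower vs

-- A clause containing vertex 0 survives the colour `r` there only if `r` is its forbidden colour;
-- otherwise it is already satisfied. A surviving clause rests on its other vertices, which is why
-- `lower` drops vertex 0.
Open : Fin 2 → Clause (ℕ.suc n) → Set
Open r (q , vs) = Any (zero ≡_) vs → r ≡ q

open? : ∀ r (γ : Clause (ℕ.suc n)) → Dec (Open r γ)
open? r (q , vs) = Any.any? (zero ≟_) vs →-dec (r ≟ q)

assign : Fin 2 → List (Clause (ℕ.suc n)) → List (Clause n)
assign r Γ = map (Product.map₂ lower) (filter (open? r) Γ)

Satisfies-lower : ∀ (c : Fin (ℕ.suc n) → Fin 2) {γ} → Open (c zero) γ → Satisfies c γ →
                  Satisfies (c ∘ suc) (Product.map₂ lower γ)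
Satisfies-lower c {q , vs} op sat below = sat (raise vs op below)
  where
  raise : ∀ vs → Open (c zero) (q , vs) → All (λ v → c (suc v) ≡ q) (lower vs) → All (λ v → c v ≡ q) vs
  raise []           op bs       = []
  raise (zero  ∷ vs) op bs       = op (here refl) ∷ raise vs (op ∘ there) bs
  raise (suc v ∷ vs) op (b ∷ bs) = b ∷ raise vs (op ∘ there) bs

assign-sound : ∀ (c : Fin (ℕ.suc n) → Fin 2) {Γ} → All (Satisfies c) Γ →
               All (Satisfies (c ∘ suc)) (assign (c zero) Γ)
assign-sound c {Γ} sat = All.map⁺ (All.zipWith (λ {γ} (op , s) → Satisfies-lower c {γ} op s)
  (All.all-filter (open? (c zero)) Γ , All.filter⁺ (open? (c zero)) sat))

-- All vertices of an empty list vacuously have the forbidden colour, so an empty clause closes its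
-- branch of the search.
violated : List (Clause n) → Bool
violated []            = false
violated ((_ , vs) ∷ Γ) = null vs ∨ violated Γ

violated-sound : ∀ (Γ : List (Clause n)) → T (violated Γ) → ∀ c → ¬ All (Satisfies c) Γ
violated-sound ((q , [])     ∷ Γ) t c (s ∷ _)  = s []
violated-sound ((q , _ ∷ _)  ∷ Γ) t c (_ ∷ ss) = violated-sound Γ t c ss

refutes : ∀ n → List (Clause n) → Bool
refutes ℕ.zero    Γ = violated Γ
refutes (ℕ.suc n) Γ = violated Γ ∨ (refutes n (assign 0F Γ) ∧ refutes n (assign 1F Γ))

refutes-sound : ∀ n (Γ : List (Clause n)) → T (refutes n Γ) → ∀ c → ¬ All (Satisfies c) Γ
refutes-sound ℕ.zero    Γ t c sat = violated-sound Γ t c sat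
refutes-sound (ℕ.suc n) Γ t c sat with Equivalence.to T-∨ t
... | inj₁ t₀ = violated-sound Γ t₀ c sat
... | inj₂ ts = let t₀ , t₁ = Equivalence.to T-∧ ts in branch (c zero) refl t₀ t₁
  where
  branch : ∀ r → c zero ≡ r → T (refutes n (assign 0F Γ)) → ¬ T (refutes n (assign 1F Γ))
  branch 0F eq t₀ t₁ =
    refutes-sound n _ t₀ (c ∘ suc) (subst (λ r → All (Satisfies (c ∘ suc)) (assign r Γ)) eq (assign-sound c sat))
  branch 1F eq t₀ t₁ =
    refutes-sound n _ t₁ (c ∘ suc) (subst (λ r → All (Satisfies (c ∘ suc)) (assign r Γ)) eq (assign-sound c sat))

-- Refuting the wrong colour vertex by vertex lets each refutation use the colours already forced on
-- the earlier vertices.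
forces : List (Clause n) → Vec (Fin 2) n → Bool
forces Γ []       = true
forces Γ (q ∷ qs) = refutes _ (assign (opposite q) Γ) ∧ forces (assign q Γ) qs

forces-sound : ∀ (Γ : List (Clause n)) qs → T (forces Γ qs) →
               ∀ c → All (Satisfies c) Γ → c ≗ Vec.lookup qs
forces-sound {n = ℕ.suc n} Γ (q ∷ qs) t c sat = go (c zero ≟ q)
  where
  t₀₁ = Equivalence.to T-∧ t

  at : ∀ {r} → c zero ≡ r → All (Satisfies (c ∘ suc)) (assign r Γ)
  at refl = assign-sound c sat

  other : ∀ r q → r ≢ q → r ≡ opposite q
  other 0F 0F r≢q = contradiction refl r≢q
  other 0F 1F r≢q = refl
  other 1F 0F r≢q = refl
  other 1F 1F r≢q = contradiction refl r≢q

  go : Dec (c zero ≡ q) → c ≗ Vec.lookup (q ∷ qs)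
  go (no c₀≢q)  _       = contradiction (at (other _ _ c₀≢q)) (refutes-sound n _ (proj₁ t₀₁) (c ∘ suc))
  go (yes c₀≡q) zero    = c₀≡q
  go (yes c₀≡q) (suc v) = forces-sound _ qs (proj₂ t₀₁) (c ∘ suc) (at c₀≡q) v

-- On `Fin 2`, `opposite` exchanges the colours, so a prescribed colour becomes a clause with a
-- single vertex that forbids the other one.
pin : (Fin n → Fin 2) → Fin n → Clause n
pin c₀ v = opposite (c₀ v) , v ∷ []

pin-sound : ∀ (c c₀ : Fin n → Fin 2) {v} → c v ≡ c₀ v → Satisfies c (pin c₀ v)
pin-sound c c₀ eq (eq′ ∷ []) = opposite-≢ _ (trans (sym eq) eq′)
  where
  opposite-≢ : ∀ (q : Fin 2) → q ≢ opposite q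
  opposite-≢ 0F ()
  opposite-≢ 1F ()

clauses : List (P₄ n) → List (Clause n)
clauses []       = []
clauses (p ∷ ps) = (0F , vertices p) ∷ (1F , vertices p) ∷ clauses ps

clauses-sound : ∀ (c : Fin n → Fin 2) {ps} → Proper c ps → All (Satisfies c) (clauses ps)
clauses-sound c []           = []
clauses-sound c (¬mono ∷ pr) = (λ cs → ¬mono (0F , cs)) ∷ (λ cs → ¬mono (1F , cs)) ∷ clauses-sound c pr

forcesFrom : List (Fin n) → Vec (Fin 2) n → List (P₄ n) → Bool
forcesFrom pinned qs ps = forces (map (pin (Vec.lookup qs)) pinned ++ clauses ps) qs

forcesFrom-sound : ∀ pinned qs (ps : List (P₄ n)) → T (forcesFrom pinned qs ps) →
                   ∀ c → Proper c ps → All (λ v → c v ≡ Vec.lookup qs v) pinned → c ≗ Vec.lookup qs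
forcesFrom-sound pinned qs ps t c proper agree = forces-sound _ qs t c
  (All.++⁺ (All.map⁺ (All.map (pin-sound c (Vec.lookup qs)) agree)) (clauses-sound c proper))

-- Adding three vertices

-- Distinctness is decided by evaluation, so explicit paths carry no written proof.
⟨_–_–_–_⟩ : (a b c d : Fin n) {_ : True (DecUnique.unique? _≟_ (a ∷ b ∷ c ∷ d ∷ []))} → P₄ n
⟨_–_–_–_⟩ a b c d {u} = path a b c d (toWitness u)

extend : (Fin n → Fin 2) → Fin (3 + n) → Fin 2
extend c 0F                  = 0F
extend c 1F                  = 1F
extend c 2F                  = 1F
extend c (suc (suc (suc v))) = c v

-- ps decomposes the graph of all edges that meet one of the new vertices 0, 1, 2.
record Joins (ps : List (P₄ (3 + n))) : Set where
  field
    new-new : ∀ (i j : Fin 3) → i ≢ j → count ps (i ↑ˡ n) (j ↑ˡ n) ≡ 1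
    new-old : ∀ (i : Fin 3) v → count ps (i ↑ˡ n) (3 ↑ʳ v) ≡ 1
    old-old : ∀ u v → count ps (3 ↑ʳ u) (3 ↑ʳ v) ≡ 0

open Joins

joins? : (ps : List (P₄ (3 + n))) → Dec (Joins ps)
joins? {n} ps = map′
  (λ (nn , no′ , oo) → record { new-new = nn ; new-old = no′ ; old-old = oo })
  (λ j → new-new j , new-old j , old-old j)
  ((all? λ i → all? λ j → ¬? (i ≟ j) →-dec (count ps (i ↑ˡ n) (j ↑ˡ n) ℕ.≟ 1))
   ×-dec (all? λ i → all? λ v → count ps (i ↑ˡ n) (3 ↑ʳ v) ℕ.≟ 1)
   ×-dec (all? λ u → all? λ v → count ps (3 ↑ʳ u) (3 ↑ʳ v) ℕ.≟ 0))

-- The parts are 0, 1, 2 and 3, 4, 5.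
K₃₃ : List (P₄ 6)
K₃₃ = ⟨ 5 – 0 – 4 – 2 ⟩ ∷ ⟨ 1 – 5 – 2 – 3 ⟩ ∷ ⟨ 0 – 3 – 1 – 4 ⟩ ∷ []

old : Fin n → Fin (3 + n)
old = 3 ↑ʳ_

old-inj : Injective _≡_ _≡_ (old {n})
old-inj = ↑ʳ-injective 3 _ _

-- The new triple 0, 1, 2 stays in place and the older vertices leave a gap at 3, 4, 5 for the
-- triple added one stage before.
skip : Fin (3 + n) → Fin (6 + n)
skip = lift 3 old

skip-inj : Injective _≡_ _≡_ (skip {n})
skip-inj = lift-injective old old-inj 3

first-inj : Injective _≡_ _≡_ (λ (i : Fin 6) → i ↑ˡ n)
first-inj = ↑ˡ-injective _ _ _

firstK₃₃ : ∀ n → List (P₄ (6 + n))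
firstK₃₃ n = map (embed (_↑ˡ n) first-inj) K₃₃

addSystem : List (P₄ (3 + n)) → List (P₄ n) → List (P₄ (3 + n))
addSystem js ps = js ++ map (embed old old-inj) ps

-- The copy of the join gives the new triple the role that the middle triple 3, 4, 5 had towards the
-- older vertices. The edges between the two triples form the K₃,₃.
addJoin : List (P₄ (3 + n)) → List (P₄ (6 + n))
addJoin {n} js = firstK₃₃ n ++ map (embed skip skip-inj) js

data Split {n} : Fin (3 + n) → Set where
  isNew : ∀ i → Split (i ↑ˡ n)
  isOld : ∀ v → Split (3 ↑ʳ v)

split : (v : Fin (3 + n)) → Split v
split 0F                  = isNew 0F
split 1F                  = isNew 1F
split 2F                  = isNew 2F
split (suc (suc (suc v))) = isOld v

old≢new : ∀ (i : Fin 3) (v : Fin n) → old v ≢ i ↑ˡ n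
old≢new 0F v ()
old≢new 1F v ()
old≢new 2F v ()

-- Edges meeting a new vertex are covered by `js` alone, edges between old vertices by the copy of
-- `ps` alone.
partitions-addSystem : ∀ {js} {ps : List (P₄ n)} → Joins js → Partitions ps → Partitions (addSystem js ps)
partitions-addSystem {n} {js} {ps} J P x y x≢y = trans (count-++ js _ x y) (go (split x) (split y) x≢y)
  where
  go : ∀ {x y} → Split x → Split y → x ≢ y → count js x y + count (map (embed old old-inj) ps) x y ≡ 1
  go (isNew i) (isNew j) x≢y = cong₂ _+_ (new-new J i j (x≢y ∘ cong (_↑ˡ n)))
    (count-outsideˡ old old-inj ps (old≢new i) (j ↑ˡ n))
  go (isNew i) (isOld v) x≢y = cong₂ _+_ (new-old J i v)
    (count-outsideˡ old old-inj ps (old≢new i) (3 ↑ʳ v))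
  go (isOld u) (isNew j) x≢y = cong₂ _+_ (trans (count-sym js (3 ↑ʳ u) (j ↑ˡ n)) (new-old J j u))
    (count-outsideʳ old old-inj ps (old≢new j) (3 ↑ʳ u))
  go (isOld u) (isOld v) x≢y = cong₂ _+_ (old-old J u v)
    (trans (count-embed old old-inj ps u v) (P u v (x≢y ∘ cong old)))

skip≢middle : ∀ (j : Fin 3) x → skip x ≢ old (j ↑ˡ n)
skip≢middle j 0F                  ()
skip≢middle j 1F                  ()
skip≢middle j 2F                  ()
skip≢middle j (suc (suc (suc v))) eq = old≢new j v (old-inj eq)

skip-new : ∀ (i : Fin 3) → skip (i ↑ˡ n) ≡ i ↑ˡ (3 + n)
skip-new 0F = refl
skip-new 1F = refl
skip-new 2F = refl

first≢rest : ∀ (v : Fin n) (i : Fin 6) → i ↑ˡ n ≢ old (old v)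
first≢rest v 0F ()
first≢rest v 1F ()
first≢rest v 2F ()
first≢rest v 3F ()
first≢rest v 4F ()
first≢rest v 5F ()

-- The K₃,₃ covers exactly the edges between the new and the middle triple. The copy of `js` avoids
-- the middle triple and covers the other edges at the new one.
joins-addJoin : ∀ {js : List (P₄ (3 + n))} → Joins js → Joins (addJoin js)
joins-addJoin {n} {js} J = record
  { new-new = λ i j i≢j → trans (count-++ k₃₃ js′ (new i) (new j)) (cong₂ _+_ (k₃₃-new i j)
      (trans (cong (count js′ (new i)) (sym (skip-new j)))
        (trans (count-js′ i (j ↑ˡ n)) (new-new J i j i≢j))))
  ; new-old = λ i v → trans (count-++ k₃₃ js′ (new i) (old v)) (mixed i (split v))
  ; old-old = λ u v → trans (count-++ k₃₃ js′ (old u) (old v)) (olds (split u) (split v))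
  }
  where
  k₃₃ js′ : List (P₄ (6 + n))
  k₃₃ = firstK₃₃ n
  js′ = map (embed skip skip-inj) js

  new middle : Fin 3 → Fin (6 + n)
  new i    = i ↑ˡ (3 + n)
  middle i = old (i ↑ˡ n)

  -- Only the first six vertices occur, so these counts evaluate although `n` is a variable.
  k₃₃-new : ∀ i j → count k₃₃ (new i) (new j) ≡ 0
  k₃₃-new = toWitness {a? = all? λ i → all? λ j → count k₃₃ (new i) (new j) ℕ.≟ 0} tt

  k₃₃-mixed : ∀ i j → count k₃₃ (new i) (middle j) ≡ 1
  k₃₃-mixed = toWitness {a? = all? λ i → all? λ j → count k₃₃ (new i) (middle j) ℕ.≟ 1} tt

  k₃₃-middle : ∀ i j → count k₃₃ (middle i) (middle j) ≡ 0
  k₃₃-middle = toWitness {a? = all? λ i → all? λ j → count k₃₃ (middle i) (middle j) ℕ.≟ 0} tt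

  k₃₃-outsideˡ : ∀ v y → count k₃₃ (old (old v)) y ≡ 0
  k₃₃-outsideˡ v = count-outsideˡ (_↑ˡ n) first-inj K₃₃ (first≢rest v)

  k₃₃-outsideʳ : ∀ x v → count k₃₃ x (old (old v)) ≡ 0
  k₃₃-outsideʳ x v = count-outsideʳ (_↑ˡ n) first-inj K₃₃ (first≢rest v) x

  js′-outsideˡ : ∀ i y → count js′ (middle i) y ≡ 0
  js′-outsideˡ i = count-outsideˡ skip skip-inj js (skip≢middle i)

  js′-outsideʳ : ∀ x j → count js′ x (middle j) ≡ 0
  js′-outsideʳ x j = count-outsideʳ skip skip-inj js (skip≢middle j) x

  count-js′ : ∀ i y → count js′ (new i) (skip y) ≡ count js (i ↑ˡ n) y
  count-js′ i y = trans (cong (λ x → count js′ x (skip y)) (sym (skip-new i)))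
                        (count-embed skip skip-inj js (i ↑ˡ n) y)

  mixed : ∀ i {v} → Split v → count k₃₃ (new i) (old v) + count js′ (new i) (old v) ≡ 1
  mixed i (isNew j) = cong₂ _+_ (k₃₃-mixed i j) (js′-outsideʳ (new i) j)
  mixed i (isOld v) = cong₂ _+_ (k₃₃-outsideʳ (new i) v)
                                (trans (count-js′ i (old v)) (new-old J i v))

  olds : ∀ {u v} → Split u → Split v → count k₃₃ (old u) (old v) + count js′ (old u) (old v) ≡ 0
  olds (isNew i) (isNew j) = cong₂ _+_ (k₃₃-middle i j) (js′-outsideˡ i (middle j))
  olds (isNew i) (isOld v) = cong₂ _+_ (k₃₃-outsideʳ (middle i) v) (js′-outsideˡ i (old (old v)))
  olds (isOld u) (isNew j) = cong₂ _+_ (k₃₃-outsideˡ u (middle j)) (js′-outsideʳ (old (old u)) j)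
  olds (isOld u) (isOld v) = cong₂ _+_ (k₃₃-outsideˡ u (old (old v)))
    (trans (count-embed skip skip-inj js (old u) (old v)) (old-old J u v))

-- The induction carries, beside a rigid system, a decomposition of the edges that three further
-- vertices will bring. Given the prescribed colours on the old vertices, this join forces those of
-- the new ones.
record Stage (n : ℕ) : Set where
  field
    root           : Fin n
    colours        : Fin n → Fin 2
    system         : List (P₄ n)
    join           : List (P₄ (3 + n))
    partitions     : Partitions system
    joins          : Joins join
    system-proper  : Proper colours system
    join-proper    : Proper (extend colours) join
    system-rigid   : Rigid root colours system
    join-rigid     : ∀ c → Proper c join → c ∘ old ≗ colours → c ≗ extend colours

nextStage : Stage n → Stage (3 + n)
nextStage {n} B = record
  { root          = old root
  ; colours       = extend colours
  ; system        = addSystem join system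
  ; join          = addJoin join
  ; partitions    = partitions-addSystem joins partitions
  ; joins         = joins-addJoin joins
  ; system-proper = All.++⁺ join-proper (Proper-embed⁺ old old-inj system-proper)
  -- The first six vertices are coloured 0, 1, 1, 0, 1, 1 whatever `colours` is, so the check on the
  -- K₃,₃ evaluates for every `n`.
  ; join-proper   = All.++⁺ (toWitness {a? = proper? (extend (extend colours)) (firstK₃₃ n)} tt)
      (Proper-embed⁺ skip skip-inj (Proper-cong (sym ∘ extend-skip) join-proper))
  ; system-rigid  = λ c proper c-root → join-rigid c (All.++⁻ˡ join proper)
      (system-rigid (c ∘ old) (Proper-embed⁻ old old-inj (All.++⁻ʳ join proper)) c-root)
  -- Composing with `skip` forgets the middle triple, so the previous join forces the colours of 0,
  -- 1, 2.
  ; join-rigid    = λ c proper c-old → step c c-old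
      (join-rigid (c ∘ skip) (Proper-embed⁻ skip skip-inj (All.++⁻ʳ (firstK₃₃ n) proper)) (c-old ∘ old))
  }
  where
  open Stage B

  extend-skip : extend (extend colours) ∘ skip ≗ extend colours
  extend-skip 0F                  = refl
  extend-skip 1F                  = refl
  extend-skip 2F                  = refl
  extend-skip (suc (suc (suc v))) = refl

  step : ∀ c → c ∘ old ≗ extend colours → c ∘ skip ≗ extend colours → c ≗ extend (extend colours)
  step c c-old c-skip 0F                  = c-skip 0F
  step c c-old c-skip 1F                  = c-skip 1F
  step c c-old c-skip 2F                  = c-skip 2F
  step c c-old c-skip (suc (suc (suc v))) = c-old v

-- Stages from finite checks

module _ {n} (colours : Vec (Fin 2) (ℕ.suc n))
         (system : List (P₄ (ℕ.suc n))) (join : List (P₄ (4 + n))) where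

  private
    c₀ = Vec.lookup colours

    extended : Vec (Fin 2) (4 + n)
    extended = 0F ∷ 1F ∷ 1F ∷ colours

    extended≗ : Vec.lookup extended ≗ extend c₀
    extended≗ 0F                  = refl
    extended≗ 1F                  = refl
    extended≗ 2F                  = refl
    extended≗ (suc (suc (suc v))) = refl

  -- Rigidity quantifies over all colourings, so it is checked by backtracking: with the root pinned
  -- for the system, and with every old vertex pinned for the join.
  baseStage : True (partitions? system) → True (joins? join) →
              True (proper? c₀ system) → True (proper? (extend c₀) join) →
              T (forcesFrom (0F ∷ []) colours system) →
              T (forcesFrom (map old (allFin (ℕ.suc n))) extended join) →
              Stage (ℕ.suc n)
  baseStage parts joins system-proper join-proper system-forced join-forced = record
    { root          = 0F
    ; colours       = c₀
    ; system        = system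
    ; join          = join
    ; partitions    = toWitness parts
    ; joins         = toWitness joins
    ; system-proper = toWitness system-proper
    ; join-proper   = toWitness join-proper
    ; system-rigid  = λ c proper c-root →
        forcesFrom-sound (0F ∷ []) colours system system-forced c proper (c-root ∷ [])
    ; join-rigid    = λ c proper c-old v → trans
        (forcesFrom-sound (map old (allFin (ℕ.suc n))) extended join join-forced c proper
          (All.map⁺ (All.universal c-old (allFin (ℕ.suc n)))) v)
        (extended≗ v)
    }

-- The base systems

-- The vertices are numbered so that backtracking in their natural order visits
-- only about five thousand nodes.
-- In the joins, the triangle 0, 1, 2 is absorbed by three paths that decompose
-- K₅ minus an edge (order 18) or by two paths that decompose K₄ (order 19); all
-- other paths come in pairs as described at the top.

colours18 : Vec (Fin 2) 18
colours18 = 0 ∷ 1 ∷ 1 ∷ 0 ∷ 0 ∷ 1 ∷ 1 ∷ 1 ∷ 0 ∷ 0 ∷ 1 ∷ 0 ∷ 1 ∷ 0 ∷ 0 ∷ 1 ∷ 0 ∷ 1 ∷ []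

system18 : List (P₄ 18)
system18 =
      ⟨ 0 – 1 – 6 – 2 ⟩ ∷ ⟨ 0 – 3 – 1 – 2 ⟩ ∷ ⟨ 0 – 4 – 15 – 5 ⟩ ∷ ⟨ 0 – 7 – 4 – 9 ⟩ ∷ ⟨ 0 – 11 – 13 – 1 ⟩
    ∷ ⟨ 0 – 12 – 4 – 11 ⟩ ∷ ⟨ 0 – 14 – 5 – 9 ⟩ ∷ ⟨ 0 – 15 – 1 – 17 ⟩ ∷ ⟨ 0 – 16 – 3 – 2 ⟩ ∷ ⟨ 1 – 4 – 3 – 5 ⟩
    ∷ ⟨ 1 – 11 – 8 – 12 ⟩ ∷ ⟨ 2 – 0 – 5 – 4 ⟩ ∷ ⟨ 2 – 5 – 17 – 8 ⟩ ∷ ⟨ 2 – 8 – 14 – 12 ⟩ ∷ ⟨ 2 – 9 – 14 – 11 ⟩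
    ∷ ⟨ 2 – 10 – 13 – 5 ⟩ ∷ ⟨ 2 – 14 – 6 – 9 ⟩ ∷ ⟨ 3 – 10 – 0 – 9 ⟩ ∷ ⟨ 3 – 11 – 10 – 7 ⟩ ∷ ⟨ 3 – 15 – 11 – 16 ⟩
    ∷ ⟨ 4 – 2 – 7 – 8 ⟩ ∷ ⟨ 4 – 6 – 5 – 10 ⟩ ∷ ⟨ 4 – 10 – 15 – 8 ⟩ ∷ ⟨ 4 – 14 – 16 – 6 ⟩ ∷ ⟨ 4 – 16 – 2 – 13 ⟩
    ∷ ⟨ 4 – 17 – 2 – 12 ⟩ ∷ ⟨ 5 – 1 – 16 – 17 ⟩ ∷ ⟨ 5 – 7 – 3 – 6 ⟩ ∷ ⟨ 5 – 12 – 15 – 14 ⟩ ∷ ⟨ 5 – 16 – 7 – 12 ⟩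
    ∷ ⟨ 6 – 8 – 3 – 12 ⟩ ∷ ⟨ 6 – 10 – 12 – 11 ⟩ ∷ ⟨ 6 – 11 – 2 – 15 ⟩ ∷ ⟨ 6 – 12 – 16 – 8 ⟩ ∷ ⟨ 6 – 13 – 3 – 9 ⟩
    ∷ ⟨ 6 – 15 – 17 – 9 ⟩ ∷ ⟨ 6 – 17 – 10 – 9 ⟩ ∷ ⟨ 7 – 6 – 0 – 8 ⟩ ∷ ⟨ 7 – 13 – 4 – 8 ⟩ ∷ ⟨ 7 – 15 – 9 – 16 ⟩
    ∷ ⟨ 7 – 17 – 14 – 10 ⟩ ∷ ⟨ 8 – 5 – 11 – 9 ⟩ ∷ ⟨ 8 – 9 – 1 – 10 ⟩ ∷ ⟨ 8 – 10 – 16 – 15 ⟩ ∷ ⟨ 9 – 7 – 1 – 12 ⟩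
    ∷ ⟨ 11 – 7 – 14 – 13 ⟩ ∷ ⟨ 11 – 17 – 13 – 16 ⟩ ∷ ⟨ 12 – 9 – 13 – 15 ⟩ ∷ ⟨ 12 – 13 – 0 – 17 ⟩ ∷ ⟨ 12 – 17 – 3 – 14 ⟩
    ∷ ⟨ 13 – 8 – 1 – 14 ⟩ ∷ []

join18 : List (P₄ 21)
join18 =
      -- Here and in `join19` the first six paths do the forcing: a pair coloured 0 with centre 1, a
      -- pair coloured 0 with centre 0, and a pair coloured 1 with centre 0. Old vertex `v` appears
      -- as `v + 3`.
      ⟨ 1 – 3 – 0 – 6 ⟩ ∷ ⟨ 1 – 6 – 2 – 3 ⟩ ∷ ⟨ 0 – 7 – 1 – 11 ⟩ ∷ ⟨ 0 – 11 – 2 – 7 ⟩ ∷ ⟨ 0 – 4 – 1 – 5 ⟩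
    ∷ ⟨ 0 – 5 – 2 – 4 ⟩ ∷ ⟨ 8 – 0 – 1 – 9 ⟩ ∷ ⟨ 8 – 1 – 2 – 0 ⟩ ∷ ⟨ 8 – 2 – 9 – 0 ⟩ ∷ ⟨ 0 – 10 – 1 – 12 ⟩
    ∷ ⟨ 0 – 12 – 2 – 10 ⟩ ∷ ⟨ 0 – 13 – 1 – 14 ⟩ ∷ ⟨ 0 – 14 – 2 – 13 ⟩ ∷ ⟨ 0 – 15 – 1 – 16 ⟩ ∷ ⟨ 0 – 16 – 2 – 15 ⟩
    ∷ ⟨ 0 – 17 – 1 – 18 ⟩ ∷ ⟨ 0 – 18 – 2 – 17 ⟩ ∷ ⟨ 0 – 19 – 1 – 20 ⟩ ∷ ⟨ 0 – 20 – 2 – 19 ⟩ ∷ []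

colours19 : Vec (Fin 2) 19
colours19 = 0 ∷ 1 ∷ 1 ∷ 1 ∷ 1 ∷ 0 ∷ 1 ∷ 0 ∷ 0 ∷ 0 ∷ 0 ∷ 0 ∷ 0 ∷ 0 ∷ 1 ∷ 1 ∷ 1 ∷ 0 ∷ 1 ∷ []

system19 : List (P₄ 19)
system19 =
      ⟨ 0 – 5 – 7 – 4 ⟩ ∷ ⟨ 0 – 11 – 13 – 1 ⟩ ∷ ⟨ 0 – 12 – 16 – 8 ⟩ ∷ ⟨ 0 – 14 – 17 – 9 ⟩ ∷ ⟨ 0 – 15 – 13 – 7 ⟩
    ∷ ⟨ 0 – 17 – 16 – 10 ⟩ ∷ ⟨ 1 – 2 – 0 – 3 ⟩ ∷ ⟨ 1 – 6 – 7 – 2 ⟩ ∷ ⟨ 1 – 7 – 11 – 17 ⟩ ∷ ⟨ 1 – 10 – 7 – 8 ⟩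
    ∷ ⟨ 1 – 12 – 10 – 4 ⟩ ∷ ⟨ 2 – 5 – 17 – 13 ⟩ ∷ ⟨ 2 – 6 – 5 – 4 ⟩ ∷ ⟨ 2 – 13 – 12 – 5 ⟩ ∷ ⟨ 2 – 15 – 18 – 10 ⟩
    ∷ ⟨ 2 – 16 – 6 – 17 ⟩ ∷ ⟨ 3 – 2 – 14 – 13 ⟩ ∷ ⟨ 3 – 4 – 2 – 8 ⟩ ∷ ⟨ 3 – 6 – 0 – 10 ⟩ ∷ ⟨ 3 – 7 – 12 – 11 ⟩
    ∷ ⟨ 3 – 9 – 11 – 5 ⟩ ∷ ⟨ 3 – 14 – 5 – 10 ⟩ ∷ ⟨ 3 – 16 – 18 – 13 ⟩ ∷ ⟨ 4 – 0 – 7 – 9 ⟩ ∷ ⟨ 4 – 1 – 3 – 5 ⟩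
    ∷ ⟨ 4 – 11 – 6 – 10 ⟩ ∷ ⟨ 4 – 12 – 15 – 17 ⟩ ∷ ⟨ 4 – 14 – 18 – 11 ⟩ ∷ ⟨ 4 – 15 – 9 – 14 ⟩ ∷ ⟨ 4 – 16 – 14 – 12 ⟩
    ∷ ⟨ 4 – 17 – 3 – 10 ⟩ ∷ ⟨ 4 – 18 – 3 – 11 ⟩ ∷ ⟨ 5 – 9 – 6 – 8 ⟩ ∷ ⟨ 6 – 15 – 16 – 13 ⟩ ∷ ⟨ 6 – 18 – 7 – 14 ⟩
    ∷ ⟨ 7 – 15 – 5 – 18 ⟩ ∷ ⟨ 7 – 16 – 1 – 17 ⟩ ∷ ⟨ 7 – 17 – 10 – 14 ⟩ ∷ ⟨ 8 – 0 – 16 – 11 ⟩ ∷ ⟨ 8 – 1 – 0 – 9 ⟩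
    ∷ ⟨ 8 – 4 – 13 – 10 ⟩ ∷ ⟨ 8 – 10 – 2 – 12 ⟩ ∷ ⟨ 8 – 12 – 17 – 18 ⟩ ∷ ⟨ 8 – 18 – 1 – 14 ⟩ ∷ ⟨ 9 – 2 – 11 – 10 ⟩
    ∷ ⟨ 9 – 4 – 6 – 14 ⟩ ∷ ⟨ 9 – 8 – 3 – 13 ⟩ ∷ ⟨ 9 – 13 – 6 – 12 ⟩ ∷ ⟨ 9 – 18 – 2 – 17 ⟩ ∷ ⟨ 11 – 1 – 5 – 13 ⟩
    ∷ ⟨ 11 – 14 – 8 – 15 ⟩ ∷ ⟨ 12 – 3 – 15 – 14 ⟩ ∷ ⟨ 12 – 9 – 10 – 15 ⟩ ∷ ⟨ 12 – 18 – 0 – 13 ⟩ ∷ ⟨ 13 – 8 – 5 – 16 ⟩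
    ∷ ⟨ 15 – 1 – 9 – 16 ⟩ ∷ ⟨ 15 – 11 – 8 – 17 ⟩ ∷ []

join19 : List (P₄ 22)
join19 =
      ⟨ 1 – 3 – 0 – 8 ⟩ ∷ ⟨ 1 – 8 – 2 – 3 ⟩ ∷ ⟨ 0 – 10 – 1 – 11 ⟩ ∷ ⟨ 0 – 11 – 2 – 10 ⟩ ∷ ⟨ 0 – 4 – 1 – 5 ⟩
    ∷ ⟨ 0 – 5 – 2 – 4 ⟩ ∷ ⟨ 6 – 0 – 1 – 2 ⟩ ∷ ⟨ 0 – 2 – 6 – 1 ⟩ ∷ ⟨ 0 – 7 – 1 – 9 ⟩ ∷ ⟨ 0 – 9 – 2 – 7 ⟩
    ∷ ⟨ 0 – 12 – 1 – 13 ⟩ ∷ ⟨ 0 – 13 – 2 – 12 ⟩ ∷ ⟨ 0 – 14 – 1 – 15 ⟩ ∷ ⟨ 0 – 15 – 2 – 14 ⟩ ∷ ⟨ 0 – 16 – 1 – 17 ⟩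
    ∷ ⟨ 0 – 17 – 2 – 16 ⟩ ∷ ⟨ 0 – 18 – 1 – 19 ⟩ ∷ ⟨ 0 – 19 – 2 – 18 ⟩ ∷ ⟨ 0 – 20 – 1 – 21 ⟩ ∷ ⟨ 0 – 21 – 2 – 20 ⟩ ∷ []

stage18 : Stage 18
stage18 = baseStage colours18 system18 join18 tt tt tt tt tt tt

stage19 : Stage 19
stage19 = baseStage colours19 system19 join19 tt tt tt tt tt tt

-- All orders in the two residue classes

stage : ∀ t → Stage n → Stage (t * 3 + n)
stage ℕ.zero    B = B
-- `suc t * 3 + n` computes to `3 + (t * 3 + n)`, the order that `nextStage` yields.
stage (ℕ.suc t) B = nextStage (stage t B)

fromStage : 1 ℕ.< n → Stage n → Σ (P₄System n) Uniquely2Chromatic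
fromStage 1<n B = rigid⇒uniquely2Chromatic 1<n system partitions system-proper system-rigid
  where open Stage B

fromBase : ∀ n r → n ≥ 109 → n % 3 ≡ r → Stage (18 + r) → Σ (P₄System n) Uniquely2Chromatic
fromBase n r n≥109 n%3≡r B =
  -- `109 / 3` evaluates to 36, which is `6 + 30`; six of the triples in `n` make up the 18 of the
  -- base order, and `t` counts the others.
  let t , 6+t≡n/3 = ℕ.m≤n⇒∃[o]m+o≡n (ℕ.≤-trans (ℕ.m≤m+n 6 30) (ℕ./-monoˡ-≤ 3 n≥109))
  in fromStage (ℕ.≤-trans (ℕ.m≤m+n 2 107) n≥109) (subst Stage (order t 6+t≡n/3) (stage t B))
  where
  open ≡-Reasoning

  order : ∀ t → 6 + t ≡ n / 3 → t * 3 + (18 + r) ≡ n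
  order t 6+t≡n/3 = begin
    t * 3 + (18 + r)     ≡⟨ ℕ.+-comm (t * 3) (18 + r) ⟩
    18 + r + t * 3       ≡⟨ cong (_+ t * 3) (ℕ.+-comm 18 r) ⟩
    -- `18 + t * 3` and `(6 + t) * 3` are equal by computation.
    r + 18 + t * 3       ≡⟨ ℕ.+-assoc r 18 (t * 3) ⟩
    r + (6 + t) * 3      ≡⟨ cong₂ (λ s q → s + q * 3) (sym n%3≡r) 6+t≡n/3 ⟩
    n % 3 + (n / 3) * 3  ≡⟨ ℕ.m≡m%n+[m/n]*n n 3 ⟨
    n                    ∎

theorem4p12 : ∀ (n : ℕ) → n ≥ 109 → (n % 3 ≡ 0) ⊎ (n % 3 ≡ 1) → Σ (P₄System n) Uniquely2Chromatic
theorem4p12 n n≥109 (inj₁ n%3≡0) = fromBase n 0 n≥109 n%3≡0 stage18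
theorem4p12 n n≥109 (inj₂ n%3≡1) = fromBase n 1 n≥109 n%3≡1 stage19
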